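{- There exists $v_0$ such that every simple graph $G$ on $v\ge v_0$ vertices that is $\frac{27}{28}$-dense, i.e. has minimum degree at least $\frac{27}{28}(v-1)$, admits a fractional decomposition into copies of the triangle $K_3$.
   Context: A fractional decomposition of a graph $G$ into copies of a graph $H$ is a set of pairs $(H_i,w_i)$ where each $H_i$ is a subgraph of $G$ isomorphic to $H$, the $w_i$ are positive rational weights, and for every edge $e$ of $G$ one has $\sum_{i:\,e\in H_i}w_i=1$ (here $e\in H_i$ means that $e$ is an edge of $H_i$). -}

module Defs where

open import Data.Nat.Base using (ℕ)
open import Data.Integer.Base as ℤ using (+_; 1ℤ)
open import Data.Rational.Base using (ℚ; 0ℚ; 1ℚ; _/_; _+_; _*_; _≤_; _<_)
open import Data.Fin.Base using (Fin)
open import Data.Fin.Properties using (_≟_)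
open import Data.Fin.Subset using (Subset; _∈_)
open import Data.List.Base using (List; length; filter; map; foldr; allFin)
open import Data.List.Relation.Unary.AllPairs using (AllPairs)
open import Data.Product.Base using (∃; _×_; proj₁)
open import Function.Base using (_∘_; _on_)
open import Function.Bundles using (_↔_; _⇔_; module Inverse)
open import Level using (0ℓ)
open import Relation.Binary.Core using (Rel; _⇒_)
open import Relation.Binary.Definitions using (Decidable; Symmetric)
open import Relation.Binary.PropositionalEquality.Core using (_≡_; _≢_; refl; ≢-sym)
open import Relation.Nullary using (¬_)
open import Relation.Nullary.Decidable using (¬?)

record SimpleGraph (V : Set) : Set₁ where
  field
    Adj    : Rel V 0ℓ
    adj?   : Decidable Adj
    sym    : Symmetric Adj
    irrefl : ∀ {x} → ¬ Adj x x

open SimpleGraph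

complete : ∀ k → SimpleGraph (Fin k)
complete k = record
  { Adj    = _≢_
  ; adj?   = λ x y → ¬? (x ≟ y)
  ; sym    = ≢-sym
  ; irrefl = λ x≢x → x≢x refl
  }

record _≅_ {V W : Set} (G : SimpleGraph V) (H : SimpleGraph W) : Set where
  field
    vertices↔ : V ↔ W
    adj⇔      : ∀ x y → Adj G x y ⇔ Adj H (Inverse.to vertices↔ x) (Inverse.to vertices↔ y)

degree : ∀ {n} → SimpleGraph (Fin n) → Fin n → ℕ
degree {n} G x = length (filter (adj? G x) (allFin n))

-- Minimum degree at least δ (n - 1).  The subtraction is in ℤ, not truncated.
Dense : ∀ {n} → ℚ → SimpleGraph (Fin n) → Set
Dense {n} δ G = ∀ x → δ * ((+ n ℤ.- 1ℤ) / 1) ≤ + degree G x / 1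

record Subgraph {n} (G : SimpleGraph (Fin n)) : Set₁ where
  field
    vertices : Subset n
    Edge     : Rel (Fin n) 0ℓ
    edge?    : Decidable Edge
    edge-sym : Symmetric Edge
    edge⇒adj : Edge ⇒ Adj G
    edge⇒∈   : ∀ {x y} → Edge x y → x ∈ vertices × y ∈ vertices

  toGraph : SimpleGraph (∃ (_∈ vertices))
  toGraph = record
    { Adj    = Edge on proj₁
    ; adj?   = λ x y → edge? (proj₁ x) (proj₁ y)
    ; sym    = edge-sym
    ; irrefl = irrefl G ∘ edge⇒adj
    }

open Subgraph

record WeightedCopy {k n} (H : SimpleGraph (Fin k)) (G : SimpleGraph (Fin n)) : Set₁ where
  field
    subgraph   : Subgraph G
    isCopy     : toGraph subgraph ≅ H
    weight     : ℚ
    weight-pos : 0ℚ < weight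

open WeightedCopy

module _ {k n} {H : SimpleGraph (Fin k)} {G : SimpleGraph (Fin n)} where

  -- Equality of the pairs (subgraph , weight): the isomorphism with H and the
  -- choice of proofs are disregarded, and edge sets are compared extensionally.
  _≈_ : Rel (WeightedCopy H G) 0ℓ
  c ≈ d = vertices (subgraph c) ≡ vertices (subgraph d)
        × (∀ x y → Edge (subgraph c) x y ⇔ Edge (subgraph d) x y)
        × weight c ≡ weight d

  weightThrough : List (WeightedCopy H G) → Fin n → Fin n → ℚ
  weightThrough cs x y =
    foldr _+_ 0ℚ (map weight (filter (λ c → edge? (subgraph c) x y) cs))

-- A finite set of pairs is a list whose entries are pairwise distinct under _≈_.
record FractionalDecomposition {k n} (G : SimpleGraph (Fin n)) (H : SimpleGraph (Fin k)) : Set₁ where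
  field
    copies   : List (WeightedCopy H G)
    distinct : AllPairs (λ c d → ¬ (c ≈ d)) copies
    covers   : ∀ x y → Adj G x y → weightThrough copies x y ≡ 1ℚ

{-# OPTIONS --safe #-}
-- In K₅ the edge ab is the combination ⅓ T₂ - ⅙ T₁ + ⅓ T₀, where Tᵢ is the sum of the triangles that
-- share i vertices with ab.  Start with weight 1/n on every triangle of G; the edge xy then lacks
-- 1 - codeg(x,y)/n ≤ 1/10.  Supply what is missing by this combination, averaged over all K₅ of G that
-- contain xy.  Since xy lies in at least (4n/5)³ ordered K₅'s, and only triangles sharing exactly
-- one vertex with xy lose weight, a triangle loses less than (3/5)(1/n) in total.
-- With triangle weights scaled by n and sums over ordered pairs and triples, the coefficients
-- ⅓, -⅙, ⅓ become 1, -½, 1.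

module Submission where

open import Defs
open import Algebra.Bundles using (CommutativeRing)
open import Data.Bool.Base using (if_then_else_; true; false)
open import Data.Nat.Base as ℕ using (ℕ; zero; suc)
import Data.Nat.Properties as ℕ
open import Data.Integer.Base as ℤ using (+_; 1ℤ)
import Data.Integer.Properties as ℤ
open import Data.Rational.Base
open import Data.Rational.Properties
import Data.Rational.Unnormalised.Base as ℚᵘ
import Data.Rational.Unnormalised.Properties as ℚᵘ
open import Data.Rational.Solver using (module +-*-Solver)
open import Data.Fin.Base as Fin using (Fin; zero; suc)
open import Data.Fin.Patterns using (0F; 1F; 2F)
import Data.Fin.Properties as Fin
open import Data.Fin.Subset using (Subset; _∈_; ⁅_⁆; _∪_)
open import Data.Fin.Subset.Properties using (x∈p∪q⁻; x∈p∪q⁺; x∈⁅x⁆; x∈⁅y⁆⇒x≡y)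
open import Data.Vec.Properties.WithK using ([]=-irrelevant)
open import Data.Sum.Base using (_⊎_; inj₁; inj₂)
open import Data.List.Base using
  (List; []; _∷_; _++_; map; foldr; length; filter; concatMap; cartesianProduct; allFin; tabulate)
open import Data.List.Relation.Unary.All as All using (All)
import Data.List.Relation.Unary.All.Properties as All
open import Data.List.Relation.Unary.AllPairs as AllPairs using (AllPairs)
import Data.List.Relation.Unary.AllPairs.Properties as AllPairs
open import Data.List.Relation.Unary.Unique.Propositional.Properties using (cartesianProduct⁺; allFin⁺)
open import Data.List.Relation.Binary.Permutation.Propositional using (_↭_; prep; swap)
  renaming (refl to ↭-refl; trans to ↭-trans)
open import Data.Product.Base using (∃; ∃-syntax; _×_; _,_; proj₁; proj₂)
open import Function.Base using (_∘_)
open import Function.Bundles using (mk⇔; mk↔ₛ′)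
open import Relation.Binary.Definitions using (Tri; tri<; tri≈; tri>)
open import Relation.Binary.PropositionalEquality
open import Relation.Nullary using (Dec; yes; no; does; ¬_; contradiction)
open import Relation.Nullary.Decidable using (from-yes; map′; ¬?; _×-dec_; _⊎-dec_)
open import Algebra.Properties.Semiring.Sum (CommutativeRing.semiring +-*-commutativeRing)
open +-*-Solver using (solve; _:+_; _:*_; _:-_; :-_; con; _:=_)

-- K₅ is the smallest clique in which triangles generate a single edge: K₄ has six edges but only
-- four triangles. In K₅ each triangle is matched with its complementary edge, and under this
-- matching the edge-triangle incidence matrix is the adjacency matrix of the Petersen graph. Its
-- eigenvalues 3, 1, -2 are nonzero, so the coefficients of the combination are forced, the negative
-- one included. The average is taken over the exact number of K₅'s through xy, which varies from
-- edge to edge. This makes every edge total exactly 1 by pure algebra; the degree condition enters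
-- only through inequalities, which keep that number and the final weights positive. With degrees at
-- least (1 - ε)n the estimate for the weights asks for (1 - 4ε)³ > 6ε. The value ε = 1/20 satisfies
-- it with room, and being larger than 1/28 it also absorbs the difference between n - 1 and n once
-- n is large.

fromℕ : ℕ → ℚ
fromℕ n = + n / 1

/1-homo-+ : ∀ i j → (i ℤ.+ j) / 1 ≡ i / 1 + j / 1
/1-homo-+ i j = toℚᵘ-injective (begin
  toℚᵘ ((i ℤ.+ j) / 1)                    ≈⟨ toℚᵘ-fromℚᵘ (ℚᵘ.mkℚᵘ (i ℤ.+ j) 0) ⟩
  ℚᵘ.mkℚᵘ (i ℤ.+ j) 0                     ≈⟨ ℚᵘ.*≡* (cong (ℤ._* 1ℤ) (cong₂ ℤ._+_ (sym (ℤ.*-identityʳ i)) (sym (ℤ.*-identityʳ j)))) ⟩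
  ℚᵘ.mkℚᵘ i 0 ℚᵘ.+ ℚᵘ.mkℚᵘ j 0            ≈⟨ ℚᵘ.+-cong (toℚᵘ-fromℚᵘ (ℚᵘ.mkℚᵘ i 0)) (toℚᵘ-fromℚᵘ (ℚᵘ.mkℚᵘ j 0)) ⟨
  toℚᵘ (i / 1) ℚᵘ.+ toℚᵘ (j / 1)          ≈⟨ toℚᵘ-homo-+ (i / 1) (j / 1) ⟨
  toℚᵘ (i / 1 + j / 1)                    ∎)
  where open ℚᵘ.≃-Reasoning

open ≤-Reasoning

-- Order and reciprocals in ℚ

0≤⇒*-monoˡ-≤ : ∀ {p q r} → 0ℚ ≤ r → p ≤ q → r * p ≤ r * q
0≤⇒*-monoˡ-≤ {r = r} 0≤r = *-monoˡ-≤-nonNeg r {{nonNegative 0≤r}}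

0≤⇒*-monoʳ-≤ : ∀ {p q r} → 0ℚ ≤ r → p ≤ q → p * r ≤ q * r
0≤⇒*-monoʳ-≤ {r = r} 0≤r = *-monoʳ-≤-nonNeg r {{nonNegative 0≤r}}

*-nonNeg : ∀ {p q} → 0ℚ ≤ p → 0ℚ ≤ q → 0ℚ ≤ p * q
*-nonNeg {p} 0≤p 0≤q = ≤-trans (≤-reflexive (sym (*-zeroʳ p))) (0≤⇒*-monoˡ-≤ 0≤p 0≤q)

*-pos : ∀ {p q} → 0ℚ < p → 0ℚ < q → 0ℚ < p * q
*-pos {p} {q} 0<p 0<q = positive⁻¹ (p * q) {{pos*pos⇒pos p {{positive 0<p}} q {{positive 0<q}}}}

p≤q⇒0≤q-p : ∀ {p q} → p ≤ q → 0ℚ ≤ q - p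
p≤q⇒0≤q-p {p} {q} p≤q = ≤-trans (≤-reflexive (sym (+-inverseʳ p))) (+-monoˡ-≤ (- p) p≤q)

0≤q-p⇒p≤q : ∀ {p q} → 0ℚ ≤ q - p → p ≤ q
0≤q-p⇒p≤q {p} {q} 0≤ = begin
  p            ≡⟨ sym (+-identityˡ p) ⟩
  0ℚ + p       ≤⟨ +-monoˡ-≤ p 0≤ ⟩
  q - p + p    ≡⟨ solve 2 (λ p q → q :- p :+ p := q) refl p q ⟩
  q            ∎

reciprocal : ∀ {p} → 0ℚ < p → ℚ
reciprocal {p} 0<p = (1/ p) {{pos⇒nonZero p {{positive 0<p}}}}

*-reciprocal : ∀ {p} (0<p : 0ℚ < p) → p * reciprocal 0<p ≡ 1ℚ
*-reciprocal {p} 0<p = *-inverseʳ p {{pos⇒nonZero p {{positive 0<p}}}}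

reciprocal-pos : ∀ {p} (0<p : 0ℚ < p) → 0ℚ < reciprocal 0<p
reciprocal-pos {p} 0<p = positive⁻¹ (reciprocal 0<p) {{1/pos⇒pos p {{positive 0<p}}}}

reciprocal-cong : ∀ {p q} (0<p : 0ℚ < p) (0<q : 0ℚ < q) → p ≡ q → reciprocal 0<p ≡ reciprocal 0<q
reciprocal-cong 0<p 0<q refl = refl

-- Finite sums

sum-mono-≤ : ∀ {n} {f g : Fin n → ℚ} → (∀ i → f i ≤ g i) → sum f ≤ sum g
sum-mono-≤ {zero}  f≤g = ≤-refl
sum-mono-≤ {suc n} f≤g = +-mono-≤ (f≤g zero) (sum-mono-≤ (f≤g ∘ suc))

sum-const : ∀ n c → ∑[ i < n ] c ≡ fromℕ n * c
sum-const zero    c = sym (*-zeroˡ c)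
sum-const (suc n) c = begin-equality
  c + ∑[ i < n ] c       ≡⟨ cong (_+_ c) (sum-const n c) ⟩
  c + fromℕ n * c        ≡⟨ solve 2 (λ c m → c :+ m :* c := (con 1ℚ :+ m) :* c) refl c (fromℕ n) ⟩
  (1ℚ + fromℕ n) * c     ≡⟨ cong (_* c) (sym (/1-homo-+ (+ 1) (+ n))) ⟩
  fromℕ (suc n) * c      ∎

∑³ : ∀ {n} → (Fin n → Fin n → Fin n → ℚ) → ℚ
∑³ {n} f = ∑[ z < n ] ∑[ d < n ] ∑[ e < n ] f z d e

∑³-cong : ∀ {n} {f g : Fin n → Fin n → Fin n → ℚ} → (∀ z d e → f z d e ≡ g z d e) → ∑³ f ≡ ∑³ g
∑³-cong f≗g = sum-cong-≗ λ z → sum-cong-≗ λ d → sum-cong-≗ λ e → f≗g z d e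

∑³-distrib-+ : ∀ {n} (f g : Fin n → Fin n → Fin n → ℚ) → ∑³ (λ z d e → f z d e + g z d e) ≡ ∑³ f + ∑³ g
∑³-distrib-+ {n} f g = trans
  (sum-cong-≗ λ z → trans (sum-cong-≗ λ d → ∑-distrib-+ (f z d) (g z d))
                          (∑-distrib-+ (λ d → sum (f z d)) (λ d → sum (g z d))))
  (∑-distrib-+ (λ z → ∑[ d < n ] sum (f z d)) (λ z → ∑[ d < n ] sum (g z d)))

∑³-*ʳ : ∀ {n} (f : Fin n → Fin n → Fin n → ℚ) c → ∑³ (λ z d e → f z d e * c) ≡ ∑³ f * c
∑³-*ʳ {n} f c = sym (trans (*-distribʳ-sum c (λ z → ∑[ d < n ] sum (f z d)))
  (sum-cong-≗ λ z → trans (*-distribʳ-sum c (λ d → sum (f z d)))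
    (sum-cong-≗ λ d → *-distribʳ-sum c (f z d))))

∑³-swap₁₂ : ∀ {n} (f : Fin n → Fin n → Fin n → ℚ) → ∑³ (λ z d e → f d z e) ≡ ∑³ f
∑³-swap₁₂ f = ∑-comm (λ z d → sum (f d z))

∑³-swap₂₃ : ∀ {n} (f : Fin n → Fin n → Fin n → ℚ) → ∑³ (λ z d e → f z e d) ≡ ∑³ f
∑³-swap₂₃ f = sum-cong-≗ λ z → ∑-comm (λ d e → f z e d)

-- Indicators

⟦_⟧ : ∀ {P : Set} → Dec P → ℚ
⟦ P? ⟧ = if does P? then 1ℚ else 0ℚ

⟦⟧-nonNeg : ∀ {P : Set} (P? : Dec P) → 0ℚ ≤ ⟦ P? ⟧
⟦⟧-nonNeg (yes _) = nonNegative⁻¹ 1ℚ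
⟦⟧-nonNeg (no  _) = ≤-refl

⟦⟧≤1 : ∀ {P : Set} (P? : Dec P) → ⟦ P? ⟧ ≤ 1ℚ
⟦⟧≤1 (yes _) = ≤-refl
⟦⟧≤1 (no  _) = nonNegative⁻¹ 1ℚ

⟦⟧-cong : ∀ {P Q : Set} (P? : Dec P) (Q? : Dec Q) → (P → Q) → (Q → P) → ⟦ P? ⟧ ≡ ⟦ Q? ⟧
⟦⟧-cong (yes p) (yes q) f g = refl
⟦⟧-cong (no ¬p) (no ¬q) f g = refl
⟦⟧-cong (yes p) (no ¬q) f g = contradiction (f p) ¬q
⟦⟧-cong (no ¬p) (yes q) f g = contradiction (g q) ¬p

⟦⟧-true : ∀ {P : Set} (P? : Dec P) → P → ⟦ P? ⟧ ≡ 1ℚ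
⟦⟧-true (yes _) _ = refl
⟦⟧-true (no ¬p) p = contradiction p ¬p

⟦⟧-false : ∀ {P : Set} (P? : Dec P) → ¬ P → ⟦ P? ⟧ ≡ 0ℚ
⟦⟧-false (yes p) ¬p = contradiction p ¬p
⟦⟧-false (no  _) _  = refl

⟦×⟧ : ∀ {P Q : Set} (P? : Dec P) (Q? : Dec Q) → ⟦ P? ×-dec Q? ⟧ ≡ ⟦ P? ⟧ * ⟦ Q? ⟧
⟦×⟧ (yes _) Q? = sym (*-identityˡ ⟦ Q? ⟧)
⟦×⟧ (no  _) Q? = sym (*-zeroˡ ⟦ Q? ⟧)

⟦⊎⟧ : ∀ {P Q : Set} (P? : Dec P) (Q? : Dec Q) → (P → ¬ Q) → ⟦ P? ⊎-dec Q? ⟧ ≡ ⟦ P? ⟧ + ⟦ Q? ⟧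
⟦⊎⟧ (yes p) (yes q) ¬pq = contradiction q (¬pq p)
⟦⊎⟧ (yes p) (no  _) ¬pq = refl
⟦⊎⟧ (no  _) Q?      ¬pq = sym (+-identityˡ ⟦ Q? ⟧)

length-filter : ∀ {A : Set} {P : A → Set} (P? : ∀ a → Dec (P a)) n (f : Fin n → A) →
                fromℕ (length (filter P? (tabulate f))) ≡ ∑[ i < n ] ⟦ P? (f i) ⟧
length-filter P? zero    f = refl
length-filter P? (suc n) f with P? (f zero)
... | yes _ = trans (/1-homo-+ (+ 1) (+ length (filter P? (tabulate (f ∘ suc)))))
                    (cong (_+_ 1ℚ) (length-filter P? n (f ∘ suc)))
... | no  _ = trans (length-filter P? n (f ∘ suc)) (sym (+-identityˡ _))

-- Clique indicators and common neighbourhoods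

module CliqueWeights {n} (G : SimpleGraph (Fin n)) where

  open SimpleGraph G using (Adj; adj?) renaming (sym to adj-sym)

  N : ℚ
  N = fromℕ n

  a : Fin n → Fin n → ℚ
  a u v = ⟦ adj? u v ⟧

  a-sym : ∀ u v → a u v ≡ a v u
  a-sym u v = ⟦⟧-cong (adj? u v) (adj? v u) adj-sym adj-sym

  -- The indicator of the common neighbourhood of `us`. Irreflexivity of `Adj` makes it 0 at members
  -- of `us`, so a list with a repeated vertex has `clique` equal to 0, and sums of `clique` over
  -- all tuples count ordered cliques.
  common : List (Fin n) → Fin n → ℚ
  common []       v = 1ℚ
  common (u ∷ us) v = a u v * common us v

  clique : List (Fin n) → ℚ
  clique []       = 1ℚ
  clique (v ∷ vs) = common vs v * clique vs

  common-↭ : ∀ {us vs} w → us ↭ vs → common us w ≡ common vs w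
  common-↭ w ↭-refl = refl
  common-↭ w (prep x us↭vs) = cong (a x w *_) (common-↭ w us↭vs)
  common-↭ w (swap {xs} {ys} x y us↭vs) = begin-equality
    a x w * (a y w * common xs w)  ≡⟨ solve 3 (λ p q r → p :* (q :* r) := q :* (p :* r)) refl (a x w) (a y w) (common xs w) ⟩
    a y w * (a x w * common xs w)  ≡⟨ cong (λ c → a y w * (a x w * c)) (common-↭ w us↭vs) ⟩
    a y w * (a x w * common ys w)  ∎
  common-↭ w (↭-trans p q) = trans (common-↭ w p) (common-↭ w q)

  clique-↭ : ∀ {us vs} → us ↭ vs → clique us ≡ clique vs
  clique-↭ ↭-refl = refl
  clique-↭ (prep x us↭vs) = cong₂ _*_ (common-↭ x us↭vs) (clique-↭ us↭vs)
  clique-↭ (swap {xs} {ys} x y us↭vs) = begin-equality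
    a y x * common xs x * (common xs y * clique xs)
      ≡⟨ solve 4 (λ p q r s → p :* q :* (r :* s) := p :* r :* (q :* s)) refl (a y x) (common xs x) (common xs y) (clique xs) ⟩
    a y x * common xs y * (common xs x * clique xs)
      ≡⟨ cong₂ _*_ (cong₂ _*_ (a-sym y x) (common-↭ y us↭vs)) (cong₂ _*_ (common-↭ x us↭vs) (clique-↭ us↭vs)) ⟩
    a x y * common ys y * (common ys x * clique ys)  ∎
  clique-↭ (↭-trans p q) = trans (clique-↭ p) (clique-↭ q)

  common-nonNeg : ∀ us v → 0ℚ ≤ common us v
  common-nonNeg []       v = nonNegative⁻¹ 1ℚ
  common-nonNeg (u ∷ us) v = *-nonNeg (⟦⟧-nonNeg (adj? u v)) (common-nonNeg us v)

  common≤1 : ∀ us v → common us v ≤ 1ℚ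
  common≤1 []       v = ≤-refl
  common≤1 (u ∷ us) v = ≤-trans (0≤⇒*-monoˡ-≤ (⟦⟧-nonNeg (adj? u v)) (common≤1 us v))
                          (≤-trans (≤-reflexive (*-identityʳ _)) (⟦⟧≤1 (adj? u v)))

  clique-nonNeg : ∀ us → 0ℚ ≤ clique us
  clique-nonNeg []       = nonNegative⁻¹ 1ℚ
  clique-nonNeg (u ∷ us) = *-nonNeg (common-nonNeg us u) (clique-nonNeg us)

  clique≤1 : ∀ us → clique us ≤ 1ℚ
  clique≤1 []       = ≤-refl
  clique≤1 (u ∷ us) = ≤-trans (0≤⇒*-monoˡ-≤ (common-nonNeg us u) (clique≤1 us))
                        (≤-trans (≤-reflexive (*-identityʳ _)) (common≤1 us u))

  ∑common≤N : ∀ us → ∑[ v < n ] common us v ≤ N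
  ∑common≤N us = begin
    ∑[ v < n ] common us v   ≤⟨ sum-mono-≤ (common≤1 us) ⟩
    ∑[ v < n ] 1ℚ            ≡⟨ sum-const n 1ℚ ⟩
    N * 1ℚ                   ≡⟨ *-identityʳ N ⟩
    N                        ∎

  -- The Bonferroni inequality for two events, with `p * q` as the indicator of their intersection.
  union-bound : ∀ {p q} → p ≤ 1ℚ → q ≤ 1ℚ → p + q ≤ p * q + 1ℚ
  union-bound {p} {q} p≤1 q≤1 = 0≤q-p⇒p≤q (begin
    0ℚ                       ≤⟨ *-nonNeg (p≤q⇒0≤q-p p≤1) (p≤q⇒0≤q-p q≤1) ⟩
    (1ℚ - p) * (1ℚ - q)      ≡⟨ solve 2 (λ p q → (con 1ℚ :- p) :* (con 1ℚ :- q) := p :* q :+ con 1ℚ :- (p :+ q)) refl p q ⟩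
    p * q + 1ℚ - (p + q)     ∎)

  module _ {s : ℚ} (degree-bound : ∀ u → N - s ≤ ∑[ v < n ] a u v) where

    -- Each vertex of the list rules out at most `s` candidates, itself among them, and by
    -- `union-bound` the losses at worst add up.
    ∑common-bound : ∀ us → N - fromℕ (length us) * s ≤ ∑[ v < n ] common us v
    ∑common-bound [] = ≤-reflexive (begin-equality
      N - 0ℚ * s      ≡⟨ solve 2 (λ N s → N :- con 0ℚ :* s := N :* con 1ℚ) refl N s ⟩
      N * 1ℚ          ≡⟨ sum-const n 1ℚ ⟨
      ∑[ v < n ] 1ℚ   ∎)
    ∑common-bound (u ∷ us) = begin
      N - fromℕ (suc k) * s
        ≡⟨ cong (λ m → N - m * s) (/1-homo-+ (+ 1) (+ k)) ⟩
      N - (1ℚ + fromℕ k) * s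
        ≡⟨ solve 3 (λ N m s → N :- (con 1ℚ :+ m) :* s := (N :- s) :+ (N :- m :* s) :- N :* con 1ℚ) refl N (fromℕ k) s ⟩
      (N - s) + (N - fromℕ k * s) - N * 1ℚ
        ≤⟨ +-mono-≤ (+-mono-≤ (degree-bound u) (∑common-bound us)) (≤-reflexive (cong -_ (sym (sum-const n 1ℚ)))) ⟩
      sum (a u) + sum (common us) - ∑[ v < n ] 1ℚ
        ≡⟨ cong (_- ∑[ v < n ] 1ℚ) (sym (∑-distrib-+ (a u) (common us))) ⟩
      ∑[ v < n ] (a u v + common us v) - ∑[ v < n ] 1ℚ
        ≤⟨ +-monoˡ-≤ (- ∑[ v < n ] 1ℚ) (sum-mono-≤ (λ v → union-bound (⟦⟧≤1 (adj? u v)) (common≤1 us v))) ⟩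
      ∑[ v < n ] (a u v * common us v + 1ℚ) - ∑[ v < n ] 1ℚ
        ≡⟨ cong (_- ∑[ v < n ] 1ℚ) (∑-distrib-+ (common (u ∷ us)) _) ⟩
      sum (common (u ∷ us)) + ∑[ v < n ] 1ℚ - ∑[ v < n ] 1ℚ
        ≡⟨ solve 2 (λ p q → p :+ q :- q := p) refl (sum (common (u ∷ us))) (∑[ v < n ] 1ℚ) ⟩
      sum (common (u ∷ us)) ∎
      where k = length us

  clique₂ : ∀ x y → clique (x ∷ y ∷ []) ≡ a x y
  clique₂ x y = trans
    (solve 1 (λ p → p :* con 1ℚ :* (con 1ℚ :* con 1ℚ) := p) refl (a y x))
    (a-sym y x)

  triple? : ∀ x y z → Dec (Adj x y × Adj x z × Adj y z)
  triple? x y z = adj? x y ×-dec adj? x z ×-dec adj? y z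

  clique₃ : ∀ x y z → clique (x ∷ y ∷ z ∷ []) ≡ ⟦ triple? x y z ⟧
  clique₃ x y z = begin-equality
    a y x * (a z x * 1ℚ) * clique (y ∷ z ∷ [])
      ≡⟨ cong₂ _*_ (cong₂ _*_ (a-sym y x) (trans (*-identityʳ (a z x)) (a-sym z x))) (clique₂ y z) ⟩
    a x y * a x z * a y z
      ≡⟨ *-assoc (a x y) (a x z) (a y z) ⟩
    a x y * (a x z * a y z)
      ≡⟨ cong (a x y *_) (⟦×⟧ (adj? x z) (adj? y z)) ⟨
    a x y * ⟦ adj? x z ×-dec adj? y z ⟧
      ≡⟨ ⟦×⟧ (adj? x y) (adj? x z ×-dec adj? y z) ⟨
    ⟦ triple? x y z ⟧ ∎

  -- For adjacent `x` and `y` this is the number of ordered triples that complete them to a K₅. The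
  -- factor `a x y` is left out on purpose: the value then stays positive on non-adjacent pairs too,
  -- so that `gain` can divide by it for every pair.
  extensions : Fin n → Fin n → ℚ
  extensions x y = ∑[ z < n ] (common (x ∷ y ∷ []) z *
    (∑[ d < n ] (common (z ∷ x ∷ y ∷ []) d * (∑[ e < n ] common (d ∷ z ∷ x ∷ y ∷ []) e))))

  extensions-sym : ∀ x y → extensions x y ≡ extensions y x
  extensions-sym x y =
    sum-cong-≗ λ z → cong₂ _*_ (common-↭ z xy↭yx)
      (sum-cong-≗ λ d → cong₂ _*_ (common-↭ d (prep z xy↭yx))
        (sum-cong-≗ λ e → common-↭ e (prep d (prep z xy↭yx))))
    where
    xy↭yx : x ∷ y ∷ [] ↭ y ∷ x ∷ []
    xy↭yx = swap x y ↭-refl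

  defect : Fin n → Fin n → ℚ
  defect x y = N - ∑[ z < n ] common (x ∷ y ∷ []) z

  defect-sym : ∀ x y → defect x y ≡ defect y x
  defect-sym x y = cong (λ c → N - c) (sum-cong-≗ λ z → common-↭ z (swap {xs = []} x y ↭-refl))

  ∑clique : ∀ us → ∑[ z < n ] clique (z ∷ us) ≡ clique us * (∑[ z < n ] common us z)
  ∑clique us = trans (sym (*-distribʳ-sum (clique us) (common us))) (*-comm (sum (common us)) (clique us))

  ∑clique* : ∀ us (f : Fin n → ℚ) →
             ∑[ z < n ] (clique (z ∷ us) * f z) ≡ clique us * (∑[ z < n ] (common us z * f z))
  ∑clique* us f = trans
    (sum-cong-≗ λ z → solve 3 (λ p q r → p :* q :* r := q :* (p :* r)) refl (common us z) (clique us) (f z))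
    (sym (*-distribˡ-sum (clique us) (λ z → common us z * f z)))

  ∑clique₅ : ∀ x y → ∑³ (λ z d e → clique (e ∷ d ∷ z ∷ x ∷ y ∷ [])) ≡ clique (x ∷ y ∷ []) * extensions x y
  ∑clique₅ x y = trans
    (sum-cong-≗ λ z → trans
      (sum-cong-≗ λ d → ∑clique (d ∷ z ∷ x ∷ y ∷ []))
      (∑clique* (z ∷ x ∷ y ∷ []) _))
    (∑clique* (x ∷ y ∷ []) _)

  -- The corrected triangle weights and their edge totals

  module _ (extensions-pos : ∀ x y → 0ℚ < extensions x y) where

    2extensions-pos : ∀ x y → 0ℚ < extensions x y + extensions x y
    2extensions-pos x y = +-mono-< (extensions-pos x y) (extensions-pos x y)

    -- Half the correction that each ordered K₅ through xy has to contribute to the edge xy.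
    gain : Fin n → Fin n → ℚ
    gain x y = defect x y * reciprocal (2extensions-pos x y)

    gain-sym : ∀ x y → gain x y ≡ gain y x
    gain-sym x y = cong₂ _*_ (defect-sym x y)
      (reciprocal-cong (2extensions-pos x y) (2extensions-pos y x)
        (cong₂ _+_ (extensions-sym x y) (extensions-sym x y)))

    2extensions*gain : ∀ x y → (extensions x y + extensions x y) * gain x y ≡ defect x y
    2extensions*gain x y = begin-equality
      E * (defect x y * r)   ≡⟨ solve 3 (λ p q r → p :* (q :* r) := q :* (p :* r)) refl E (defect x y) r ⟩
      defect x y * (E * r)   ≡⟨ cong (defect x y *_) (*-reciprocal (2extensions-pos x y)) ⟩
      defect x y * 1ℚ        ≡⟨ *-identityʳ (defect x y) ⟩
      defect x y             ∎
      where
      E = extensions x y + extensions x y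
      r = reciprocal (2extensions-pos x y)

    gain-nonNeg : ∀ x y → 0ℚ ≤ gain x y
    gain-nonNeg x y = *-cancelˡ-≤-pos E (begin
      E * 0ℚ          ≡⟨ *-zeroʳ E ⟩
      0ℚ              ≤⟨ p≤q⇒0≤q-p (∑common≤N (x ∷ y ∷ [])) ⟩
      defect x y      ≡⟨ 2extensions*gain x y ⟨
      E * gain x y    ∎)
      where
      E = extensions x y + extensions x y
      instance
        E>0 : Positive E
        E>0 = positive (2extensions-pos x y)

    -- Here `x`, `y`, `z` form a triangle of a K₅ whose other vertices are `d` and `e`. The four
    -- edges in `inner` share two or no vertices with the triangle and have coefficient 1; the six
    -- edges in `mixed` share one and have coefficient -½. As `gain` is already halved, `correction`
    -- uses 2 and -1. The term `gain x y` is bracketed apart because it alone survives summation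
    -- over K₅'s through `x` and `y`.
    inner : (x y z d e : Fin n) → ℚ
    inner x y z d e = gain x y + (gain x z + gain y z + gain d e)

    mixed : (x y z d e : Fin n) → ℚ
    mixed x y z d e = (gain x d + gain x e) + (gain y d + gain y e) + (gain z d + gain z e)

    correction : (x y z d e : Fin n) → ℚ
    correction x y z d e = inner x y z d e + inner x y z d e - mixed x y z d e

    scaledWeight : (x y z : Fin n) → ℚ
    scaledWeight x y z = clique (x ∷ y ∷ z ∷ []) +
      ∑[ d < n ] ∑[ e < n ] (clique (e ∷ d ∷ x ∷ y ∷ z ∷ []) * correction x y z d e)

    scaledWeight-swap₁₂ : ∀ x y z → scaledWeight x y z ≡ scaledWeight y x z
    scaledWeight-swap₁₂ x y z = cong₂ _+_ (clique-↭ π)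
      (sum-cong-≗ λ d → sum-cong-≗ λ e → cong₂ _*_ (clique-↭ (prep e (prep d π))) (correction-swap d e))
      where
      π : x ∷ y ∷ z ∷ [] ↭ y ∷ x ∷ z ∷ []
      π = swap x y ↭-refl
      correction-swap : ∀ d e → correction x y z d e ≡ correction y x z d e
      correction-swap d e = cong₂ (λ p m → p + p - m)
        (cong₂ _+_ (gain-sym x y) (cong (_+ gain d e) (+-comm (gain x z) (gain y z))))
        (cong (_+ (gain z d + gain z e)) (+-comm (gain x d + gain x e) (gain y d + gain y e)))

    scaledWeight-swap₂₃ : ∀ x y z → scaledWeight x y z ≡ scaledWeight x z y
    scaledWeight-swap₂₃ x y z = cong₂ _+_ (clique-↭ π)
      (sum-cong-≗ λ d → sum-cong-≗ λ e → cong₂ _*_ (clique-↭ (prep e (prep d π))) (correction-swap d e))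
      where
      π : x ∷ y ∷ z ∷ [] ↭ x ∷ z ∷ y ∷ []
      π = prep x (swap y z ↭-refl)
      correction-swap : ∀ d e → correction x y z d e ≡ correction x z y d e
      correction-swap d e = cong₂ (λ p m → p + p - m)
        (trans (cong (λ p → gain x y + (gain x z + p + gain d e)) (gain-sym y z))
          (solve 4 (λ xy xz yz de → xy :+ (xz :+ yz :+ de) := xz :+ (xy :+ yz :+ de)) refl
            (gain x y) (gain x z) (gain z y) (gain d e)))
        (solve 3 (λ p q r → p :+ q :+ r := p :+ r :+ q) refl
          (gain x d + gain x e) (gain y d + gain y e) (gain z d + gain z e))

    -- Every K₅ term has the indicator of the triangle itself as a factor, so a triple that is not a
    -- triangle receives no correction.
    scaledWeight≡0 : ∀ x y z → clique (x ∷ y ∷ z ∷ []) ≡ 0ℚ → scaledWeight x y z ≡ 0ℚ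
    scaledWeight≡0 x y z eq = begin-equality
      clique xyz + ∑[ d < n ] ∑[ e < n ] (clique (e ∷ d ∷ xyz) * correction x y z d e)
        ≡⟨ cong₂ _+_ eq (sum-cong-≗ λ d → sum-cong-≗ λ e → vanish d e) ⟩
      0ℚ + ∑[ d < n ] ∑[ e < n ] 0ℚ
        ≡⟨ +-identityˡ (∑[ d < n ] ∑[ e < n ] 0ℚ) ⟩
      ∑[ d < n ] ∑[ e < n ] 0ℚ
        ≡⟨ trans (sum-cong-≗ {n} λ d → sum-replicate-zero n) (sum-replicate-zero n) ⟩
      0ℚ ∎
      where
      xyz = x ∷ y ∷ z ∷ []
      vanish : ∀ d e → clique (e ∷ d ∷ xyz) * correction x y z d e ≡ 0ℚ
      vanish d e = begin-equality
        common (d ∷ xyz) e * (common xyz d * clique xyz) * correction x y z d e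
          ≡⟨ cong (λ c → common (d ∷ xyz) e * (common xyz d * c) * correction x y z d e) eq ⟩
        common (d ∷ xyz) e * (common xyz d * 0ℚ) * correction x y z d e
          ≡⟨ solve 3 (λ p q c → p :* (q :* con 0ℚ) :* c := con 0ℚ) refl
               (common (d ∷ xyz) e) (common xyz d) (correction x y z d e) ⟩
        0ℚ ∎

    -- The initial weights contribute the codegree. Among the corrections only that of the edge
    -- `x y` itself remains, twice `gain x y` for each ordered extension, and `gain` is normalised
    -- so that this adds up to the `defect`.
    ∑scaledWeight : ∀ x y → ∑[ z < n ] scaledWeight x y z ≡ clique (x ∷ y ∷ []) * N
    ∑scaledWeight x y = begin-equality
      ∑[ z < n ] scaledWeight x y z
        ≡⟨ ∑-distrib-+ (λ z → clique (x ∷ y ∷ z ∷ [])) _ ⟩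
      ∑[ z < n ] clique (x ∷ y ∷ z ∷ []) + ∑³ (λ z d e → clique (e ∷ d ∷ x ∷ y ∷ z ∷ []) * correction x y z d e)
        ≡⟨ cong₂ _+_ (sum-cong-≗ λ z → clique-↭ (rotate z)) (∑³-cong λ z d e →
             cong (_* correction x y z d e) (clique-↭ (prep e (prep d (rotate z))))) ⟩
      ∑[ z < n ] clique (z ∷ xy) + ∑³ (λ z d e → C z d e * correction x y z d e)
        ≡⟨ cong₂ _+_ (∑clique xy) ∑correction ⟩
      clique xy * codegree + ∑³ C * (gain x y + gain x y)
        ≡⟨ cong (λ c → clique xy * codegree + c * (gain x y + gain x y)) (∑clique₅ x y) ⟩
      clique xy * codegree + clique xy * extensions x y * (gain x y + gain x y)
        ≡⟨ solve 4 (λ k c E g → k :* c :+ k :* E :* (g :+ g) := k :* (c :+ (E :+ E) :* g)) refl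
             (clique xy) codegree (extensions x y) (gain x y) ⟩
      clique xy * (codegree + (extensions x y + extensions x y) * gain x y)
        ≡⟨ cong (λ c → clique xy * (codegree + c)) (2extensions*gain x y) ⟩
      clique xy * (codegree + (N - codegree))
        ≡⟨ cong (clique xy *_) (solve 2 (λ c N → c :+ (N :- c) := N) refl codegree N) ⟩
      clique xy * N ∎
      where
      xy = x ∷ y ∷ []
      codegree = ∑[ z < n ] common xy z

      rotate : ∀ z → x ∷ y ∷ z ∷ [] ↭ z ∷ x ∷ y ∷ []
      rotate z = ↭-trans (prep x (swap y z ↭-refl)) (swap x z ↭-refl)

      C F CF : Fin n → Fin n → Fin n → ℚ
      C z d e = clique (e ∷ d ∷ z ∷ xy)
      F z d e = gain x z + gain y z + gain d e
      CF z d e = C z d e * F z d e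

      C-swap₁₂ : ∀ z d e → C z d e ≡ C d z e
      C-swap₁₂ z d e = clique-↭ (prep e (swap {xs = xy} d z ↭-refl))

      C-swap₂₃ : ∀ z d e → C z d e ≡ C z e d
      C-swap₂₃ z d e = clique-↭ (swap {xs = z ∷ xy} e d ↭-refl)

      -- C is symmetric in z, d, e, so the three sums ∑ C F with permuted arguments cancel.
      correction-split : ∀ z d e → correction x y z d e ≡
        gain x y + gain x y + (F z d e + F z d e - (F d z e + F e z d))
      correction-split z d e = begin-equality
        correction x y z d e
          ≡⟨ solve 3 (λ g f m → g :+ f :+ (g :+ f) :- m := g :+ g :+ (f :+ f :- m)) refl
               (gain x y) (F z d e) (mixed x y z d e) ⟩
        gain x y + gain x y + (F z d e + F z d e - mixed x y z d e)
          ≡⟨ cong (λ m → gain x y + gain x y + (F z d e + F z d e - m))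
               (solve 6 (λ xd xe yd ye zd ze → xd :+ xe :+ (yd :+ ye) :+ (zd :+ ze) := xd :+ yd :+ ze :+ (xe :+ ye :+ zd))
                 refl (gain x d) (gain x e) (gain y d) (gain y e) (gain z d) (gain z e)) ⟩
        gain x y + gain x y + (F z d e + F z d e - (F d z e + F e z d)) ∎

      ∑CF₁₂ : ∑³ (λ z d e → CF d z e) ≡ ∑³ CF
      ∑CF₁₂ = ∑³-swap₁₂ CF

      ∑CF₁₃ : ∑³ (λ z d e → CF e z d) ≡ ∑³ CF
      ∑CF₁₃ = trans (∑³-swap₂₃ (λ z e d → CF e z d)) ∑CF₁₂

      ∑correction : ∑³ (λ z d e → C z d e * correction x y z d e) ≡ ∑³ C * (gain x y + gain x y)
      ∑correction = begin-equality
        ∑³ (λ z d e → C z d e * correction x y z d e)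
          ≡⟨ ∑³-cong expand ⟩
        ∑³ (λ z d e → C z d e * (gain x y + gain x y) + (CF z d e + CF z d e + (CF d z e + CF e z d) * - 1ℚ))
          ≡⟨ ∑³-distrib-+ (λ z d e → C z d e * (gain x y + gain x y)) _ ⟩
        ∑³ (λ z d e → C z d e * (gain x y + gain x y)) + ∑³ (λ z d e → CF z d e + CF z d e + (CF d z e + CF e z d) * - 1ℚ)
          ≡⟨ cong₂ _+_ (∑³-*ʳ C (gain x y + gain x y)) (begin-equality
            ∑³ (λ z d e → CF z d e + CF z d e + (CF d z e + CF e z d) * - 1ℚ)
              ≡⟨ ∑³-distrib-+ (λ z d e → CF z d e + CF z d e) _ ⟩
            ∑³ (λ z d e → CF z d e + CF z d e) + ∑³ (λ z d e → (CF d z e + CF e z d) * - 1ℚ)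
              ≡⟨ cong₂ _+_ (∑³-distrib-+ CF CF) (trans (∑³-*ʳ (λ z d e → CF d z e + CF e z d) (- 1ℚ))
                   (cong (_* - 1ℚ) (trans (∑³-distrib-+ (λ z d e → CF d z e) _) (cong₂ _+_ ∑CF₁₂ ∑CF₁₃)))) ⟩
            ∑³ CF + ∑³ CF + (∑³ CF + ∑³ CF) * - 1ℚ
              ≡⟨ solve 1 (λ p → p :+ p :+ (p :+ p) :* (:- con 1ℚ) := con 0ℚ) refl (∑³ CF) ⟩
            0ℚ ∎) ⟩
        ∑³ C * (gain x y + gain x y) + 0ℚ
          ≡⟨ +-identityʳ _ ⟩
        ∑³ C * (gain x y + gain x y) ∎
        where
        expand : ∀ z d e → C z d e * correction x y z d e ≡
          C z d e * (gain x y + gain x y) + (CF z d e + CF z d e + (CF d z e + CF e z d) * - 1ℚ)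
        expand z d e = begin-equality
          C z d e * correction x y z d e
            ≡⟨ cong (C z d e *_) (correction-split z d e) ⟩
          C z d e * (gain x y + gain x y + (F z d e + F z d e - (F d z e + F e z d)))
            ≡⟨ solve 5 (λ c g p q r → c :* (g :+ (p :+ p :- (q :+ r))) :=
                 c :* g :+ (c :* p :+ c :* p :+ (c :* q :+ c :* r) :* (:- con 1ℚ))) refl
                 (C z d e) (gain x y + gain x y) (F z d e) (F d z e) (F e z d) ⟩
          C z d e * (gain x y + gain x y) + (CF z d e + CF z d e + (C z d e * F d z e + C z d e * F e z d) * - 1ℚ)
            ≡⟨ cong₂ (λ p q → C z d e * (gain x y + gain x y) + (CF z d e + CF z d e + (p * F d z e + q * F e z d) * - 1ℚ))
                 (C-swap₁₂ z d e) (trans (C-swap₂₃ z d e) (C-swap₁₂ z e d)) ⟩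
          C z d e * (gain x y + gain x y) + (CF z d e + CF z d e + (CF d z e + CF e z d) * - 1ℚ) ∎

  -- Positivity of the corrected weights for degrees at least 19n/20

  module _ {s : ℚ} (0<s : 0ℚ < s) (N≡20s : N ≡ + 20 / 1 * s)
           (degree-bound : ∀ u → N - s ≤ ∑[ v < n ] a u v) where

    -- A K₅ is built by choosing neighbours common to at most four earlier vertices, which leaves at
    -- least 20s - 4s candidates.
    r : ℚ
    r = + 16 / 1 * s

    r-nonNeg : 0ℚ ≤ r
    r-nonNeg = <⇒≤ (*-pos (positive⁻¹ (+ 16 / 1)) 0<s)

    r³ : ℚ
    r³ = r * (r * r)

    r³-pos : 0ℚ < r³
    r³-pos = *-pos 0<r (*-pos 0<r 0<r)
      where
      0<r : 0ℚ < r
      0<r = *-pos (positive⁻¹ (+ 16 / 1)) 0<s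

    r≤∑common : ∀ us → fromℕ (length us) ≤ + 4 / 1 → r ≤ ∑[ v < n ] common us v
    r≤∑common us ∣us∣≤4 = begin
      + 16 / 1 * s                 ≡⟨ solve 1 (λ s → con (+ 16 / 1) :* s := con (+ 20 / 1) :* s :- con (+ 4 / 1) :* s) refl s ⟩
      + 20 / 1 * s - + 4 / 1 * s   ≡⟨ cong (_- + 4 / 1 * s) N≡20s ⟨
      N - + 4 / 1 * s              ≤⟨ +-monoʳ-≤ N (neg-antimono-≤ (0≤⇒*-monoʳ-≤ (<⇒≤ 0<s) ∣us∣≤4)) ⟩
      N - fromℕ (length us) * s    ≤⟨ ∑common-bound degree-bound us ⟩
      ∑[ v < n ] common us v       ∎

    ∑common*-bound : ∀ us (f : Fin n → ℚ) {b} → fromℕ (length us) ≤ + 4 / 1 → 0ℚ ≤ b → (∀ v → b ≤ f v) →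
                     r * b ≤ ∑[ v < n ] (common us v * f v)
    ∑common*-bound us f {b} ∣us∣≤4 0≤b b≤f = begin
      r * b                              ≤⟨ 0≤⇒*-monoʳ-≤ 0≤b (r≤∑common us ∣us∣≤4) ⟩
      sum (common us) * b                ≡⟨ *-distribʳ-sum b (common us) ⟩
      ∑[ v < n ] (common us v * b)       ≤⟨ sum-mono-≤ (λ v → 0≤⇒*-monoˡ-≤ (common-nonNeg us v) (b≤f v)) ⟩
      ∑[ v < n ] (common us v * f v)     ∎

    -- The vertices `z`, `d`, `e` come from common neighbourhoods of two, three and four vertices.
    -- The bound for four serves all three, in place of the sharper product of 18s, 17s and 16s.
    r³≤extensions : ∀ x y → r³ ≤ extensions x y
    r³≤extensions x y =
      ∑common*-bound (x ∷ y ∷ []) _ (from-yes (+ 2 / 1 ≤? + 4 / 1)) (*-nonNeg r-nonNeg r-nonNeg) λ z →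
      ∑common*-bound (z ∷ x ∷ y ∷ []) _ (from-yes (+ 3 / 1 ≤? + 4 / 1)) r-nonNeg λ d →
      r≤∑common (d ∷ z ∷ x ∷ y ∷ []) ≤-refl

    extensions-pos : ∀ x y → 0ℚ < extensions x y
    extensions-pos x y = <-≤-trans r³-pos (r³≤extensions x y)

    defect≤2s : ∀ x y → defect x y ≤ s + s
    defect≤2s x y = begin
      N - ∑[ z < n ] common (x ∷ y ∷ []) z   ≤⟨ +-monoʳ-≤ N (neg-antimono-≤ (∑common-bound degree-bound (x ∷ y ∷ []))) ⟩
      N - (N - + 2 / 1 * s)                  ≡⟨ solve 2 (λ N s → N :- (N :- con (+ 2 / 1) :* s) := s :+ s) refl N s ⟩
      s + s                                  ∎

    triangleWeight : (x y z : Fin n) → ℚ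
    triangleWeight = scaledWeight extensions-pos

    g : Fin n → Fin n → ℚ
    g = gain extensions-pos

    -- A gain is a defect of at most 2s divided by twice a count of at least `r³`. This estimate and
    -- the next ones are multiplied through by `r³`, which keeps them free of division.
    gain-bound : ∀ x y → g x y * r³ ≤ s
    gain-bound x y = *-cancelˡ-≤-pos (+ 2 / 1) (begin
      + 2 / 1 * (g x y * r³)
        ≡⟨ solve 2 (λ g p → con (+ 2 / 1) :* (g :* p) := (p :+ p) :* g) refl (g x y) r³ ⟩
      (r³ + r³) * g x y
        ≤⟨ 0≤⇒*-monoʳ-≤ (gain-nonNeg extensions-pos x y) (+-mono-≤ (r³≤extensions x y) (r³≤extensions x y)) ⟩
      (extensions x y + extensions x y) * g x y
        ≡⟨ 2extensions*gain extensions-pos x y ⟩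
      defect x y
        ≤⟨ defect≤2s x y ⟩
      s + s
        ≡⟨ solve 1 (λ s → s :+ s := con (+ 2 / 1) :* s) refl s ⟩
      + 2 / 1 * s ∎)

    mixed-bound : ∀ x y z d e → mixed extensions-pos x y z d e * r³ ≤ + 6 / 1 * s
    mixed-bound x y z d e = begin
      (g x d + g x e + (g y d + g y e) + (g z d + g z e)) * r³
        ≡⟨ *-distribʳ-+ r³ (g x d + g x e + (g y d + g y e)) (g z d + g z e) ⟩
      (g x d + g x e + (g y d + g y e)) * r³ + (g z d + g z e) * r³
        ≡⟨ cong (_+ (g z d + g z e) * r³) (*-distribʳ-+ r³ (g x d + g x e) (g y d + g y e)) ⟩
      (g x d + g x e) * r³ + (g y d + g y e) * r³ + (g z d + g z e) * r³
        ≤⟨ +-mono-≤ (+-mono-≤ (pair-bound x) (pair-bound y)) (pair-bound z) ⟩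
      s + s + (s + s) + (s + s)
        ≡⟨ solve 1 (λ s → s :+ s :+ (s :+ s) :+ (s :+ s) := con (+ 6 / 1) :* s) refl s ⟩
      + 6 / 1 * s ∎
      where
      pair-bound : ∀ u → (g u d + g u e) * r³ ≤ s + s
      pair-bound u = ≤-trans (≤-reflexive (*-distribʳ-+ r³ (g u d) (g u e)))
                       (+-mono-≤ (gain-bound u d) (gain-bound u e))

    -- Only `mixed` takes weight away. The worst case drops `inner`, sets the clique indicator to 1
    -- and charges all six mixed gains at their maximum.
    correction-bound : ∀ us x y z d e → - (+ 6 / 1 * s) ≤ clique us * correction extensions-pos x y z d e * r³
    correction-bound us x y z d e = begin
      - (+ 6 / 1 * s)
        ≤⟨ neg-antimono-≤ (mixed-bound x y z d e) ⟩
      - (m * r³)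
        ≡⟨ cong -_ (sym (*-identityˡ (m * r³))) ⟩
      - (1ℚ * (m * r³))
        ≤⟨ neg-antimono-≤ (0≤⇒*-monoʳ-≤ (*-nonNeg m-nonNeg (<⇒≤ r³-pos)) (clique≤1 us)) ⟩
      - (k * (m * r³))
        ≡⟨ solve 3 (λ k m p → :- (k :* (m :* p)) := k :* (con 0ℚ :+ con 0ℚ :- m) :* p) refl k m r³ ⟩
      k * (0ℚ + 0ℚ - m) * r³
        ≤⟨ 0≤⇒*-monoʳ-≤ (<⇒≤ r³-pos) (0≤⇒*-monoˡ-≤ (clique-nonNeg us)
             (+-monoˡ-≤ (- m) (+-mono-≤ inner-nonNeg inner-nonNeg))) ⟩
      k * correction extensions-pos x y z d e * r³ ∎
      where
      k = clique us
      m = mixed extensions-pos x y z d e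

      g≥0 : ∀ u v → 0ℚ ≤ g u v
      g≥0 = gain-nonNeg extensions-pos

      inner-nonNeg : 0ℚ ≤ inner extensions-pos x y z d e
      inner-nonNeg = +-mono-≤ (g≥0 x y) (+-mono-≤ (+-mono-≤ (g≥0 x z) (g≥0 y z)) (g≥0 d e))

      m-nonNeg : 0ℚ ≤ m
      m-nonNeg = +-mono-≤ (+-mono-≤ (+-mono-≤ (g≥0 x d) (g≥0 x e)) (+-mono-≤ (g≥0 y d) (g≥0 y e)))
                          (+-mono-≤ (g≥0 z d) (g≥0 z e))

    triangleWeight-pos : ∀ x y z → clique (x ∷ y ∷ z ∷ []) ≡ 1ℚ → 0ℚ < triangleWeight x y z
    triangleWeight-pos x y z xyz≡1 = *-cancelʳ-<-nonNeg r³ {{nonNegative (<⇒≤ r³-pos)}} (begin-strict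
      0ℚ * r³
        ≡⟨ *-zeroˡ r³ ⟩
      0ℚ
        -- 1696 = 16³ - 6 · 20²: the scaled initial weight `r³` less the greatest possible loss 6s
        -- from each of the `N * N` pairs `d`, `e`.
        <⟨ *-pos (positive⁻¹ (+ 1696 / 1)) (*-pos 0<s (*-pos 0<s 0<s)) ⟩
      + 1696 / 1 * (s * (s * s))
        ≡⟨ solve 1 (λ s → con (+ 1696 / 1) :* (s :* (s :* s)) :=
             con (+ 16 / 1) :* s :* (con (+ 16 / 1) :* s :* (con (+ 16 / 1) :* s)) :+
             con (+ 20 / 1) :* s :* (con (+ 20 / 1) :* s :* (:- (con (+ 6 / 1) :* s)))) refl s ⟩
      r³ + + 20 / 1 * s * (+ 20 / 1 * s * (- (+ 6 / 1 * s)))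
        ≡⟨ cong (λ N → r³ + N * (N * (- (+ 6 / 1 * s)))) N≡20s ⟨
      r³ + N * (N * (- (+ 6 / 1 * s)))
        ≡⟨ cong (_+_ r³) (trans (sum-cong-≗ {n} λ d → sum-const n (- (+ 6 / 1 * s))) (sum-const n (N * (- (+ 6 / 1 * s))))) ⟨
      r³ + ∑[ d < n ] ∑[ e < n ] (- (+ 6 / 1 * s))
        ≤⟨ +-monoʳ-≤ r³ (sum-mono-≤ λ d → sum-mono-≤ λ e → correction-bound (e ∷ d ∷ xyz) x y z d e) ⟩
      r³ + ∑[ d < n ] ∑[ e < n ] (f d e * r³)
        ≡⟨ cong₂ _+_ (sym (*-identityˡ r³)) (trans (sum-cong-≗ {n} λ d → sym (*-distribʳ-sum r³ (f d)))
             (sym (*-distribʳ-sum r³ (λ d → sum (f d))))) ⟩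
      1ℚ * r³ + (∑[ d < n ] ∑[ e < n ] f d e) * r³
        ≡⟨ *-distribʳ-+ r³ 1ℚ (∑[ d < n ] ∑[ e < n ] f d e) ⟨
      (1ℚ + ∑[ d < n ] ∑[ e < n ] f d e) * r³
        ≡⟨ cong (λ c → (c + ∑[ d < n ] ∑[ e < n ] f d e) * r³) xyz≡1 ⟨
      triangleWeight x y z * r³ ∎)
      where
      xyz = x ∷ y ∷ z ∷ []
      f : Fin n → Fin n → ℚ
      f d e = clique (e ∷ d ∷ xyz) * correction extensions-pos x y z d e

-- From edge weights to decompositions

∑-δ : ∀ {n} (x : Fin n) (f : Fin n → ℚ) → ∑[ i < n ] (⟦ x Fin.≟ i ⟧ * f i) ≡ f x
∑-δ {suc n} zero f = begin-equality
  1ℚ * f zero + ∑[ i < n ] (0ℚ * f (suc i))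
    ≡⟨ cong₂ _+_ (*-identityˡ (f zero)) (trans (sum-cong-≗ λ i → *-zeroˡ (f (suc i))) (sum-replicate-zero n)) ⟩
  f zero + 0ℚ
    ≡⟨ +-identityʳ (f zero) ⟩
  f zero ∎
∑-δ {suc n} (suc x) f = begin-equality
  0ℚ * f zero + ∑[ i < n ] (⟦ x Fin.≟ i ⟧ * f (suc i))
    ≡⟨ cong₂ _+_ (*-zeroˡ (f zero)) (∑-δ x (f ∘ suc)) ⟩
  0ℚ + f (suc x)
    ≡⟨ +-identityˡ (f (suc x)) ⟩
  f (suc x) ∎

∑∑-δ : ∀ {m n} (x : Fin m) (f : Fin m → Fin n → ℚ) →
       ∑[ i < m ] ∑[ j < n ] (⟦ x Fin.≟ i ⟧ * f i j) ≡ ∑[ j < n ] f x j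
∑∑-δ x f = trans (sum-cong-≗ λ i → sym (*-distribˡ-sum ⟦ x Fin.≟ i ⟧ (f i))) (∑-δ x (sum ∘ f))

∑ˡ : ∀ {A : Set} → (A → ℚ) → List A → ℚ
∑ˡ f = foldr (λ a q → f a + q) 0ℚ

∑ˡ-++ : ∀ {A : Set} (f : A → ℚ) as bs → ∑ˡ f (as ++ bs) ≡ ∑ˡ f as + ∑ˡ f bs
∑ˡ-++ f []       bs = sym (+-identityˡ (∑ˡ f bs))
∑ˡ-++ f (a ∷ as) bs = trans (cong (_+_ (f a)) (∑ˡ-++ f as bs)) (sym (+-assoc (f a) (∑ˡ f as) (∑ˡ f bs)))

∑ˡ-map : ∀ {A B : Set} (f : B → ℚ) (h : A → B) as → ∑ˡ f (map h as) ≡ ∑ˡ (f ∘ h) as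
∑ˡ-map f h []       = refl
∑ˡ-map f h (a ∷ as) = cong (_+_ (f (h a))) (∑ˡ-map f h as)

∑ˡ-cartesianProduct : ∀ {A B : Set} (f : A × B → ℚ) as bs →
                      ∑ˡ f (cartesianProduct as bs) ≡ ∑ˡ (λ a → ∑ˡ (λ b → f (a , b)) bs) as
∑ˡ-cartesianProduct f []       bs = refl
∑ˡ-cartesianProduct f (a ∷ as) bs = trans (∑ˡ-++ f (map (a ,_) bs) (cartesianProduct as bs))
  (cong₂ _+_ (∑ˡ-map f (a ,_) bs) (∑ˡ-cartesianProduct f as bs))

∑ˡ-tabulate : ∀ {A : Set} {n} (f : A → ℚ) (h : Fin n → A) → ∑ˡ f (tabulate h) ≡ ∑[ i < n ] f (h i)
∑ˡ-tabulate {n = zero}  f h = refl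
∑ˡ-tabulate {n = suc n} f h = cong (_+_ (f (h zero))) (∑ˡ-tabulate f (h ∘ suc))

∑ˡ-allFin : ∀ {n} (f : Fin n → ℚ) → ∑ˡ f (allFin n) ≡ sum f
∑ˡ-allFin f = ∑ˡ-tabulate f (λ i → i)

triples : ∀ n → List (Fin n × Fin n × Fin n)
triples n = cartesianProduct (allFin n) (cartesianProduct (allFin n) (allFin n))

∑ˡ-triples : ∀ {n} (f : Fin n × Fin n × Fin n → ℚ) →
             ∑ˡ f (triples n) ≡ ∑[ i < n ] ∑[ j < n ] ∑[ k < n ] f (i , j , k)
∑ˡ-triples {n} f = begin-equality
  ∑ˡ f (triples n)
    ≡⟨ ∑ˡ-cartesianProduct f (allFin n) (cartesianProduct (allFin n) (allFin n)) ⟩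
  ∑ˡ (λ i → ∑ˡ (λ p → f (i , p)) (cartesianProduct (allFin n) (allFin n))) (allFin n)
    ≡⟨ ∑ˡ-allFin (λ i → ∑ˡ (λ p → f (i , p)) (cartesianProduct (allFin n) (allFin n))) ⟩
  ∑[ i < n ] ∑ˡ (λ p → f (i , p)) (cartesianProduct (allFin n) (allFin n))
    ≡⟨ sum-cong-≗ (λ i → ∑ˡ-cartesianProduct (λ p → f (i , p)) (allFin n) (allFin n)) ⟩
  ∑[ i < n ] ∑ˡ (λ j → ∑ˡ (λ k → f (i , j , k)) (allFin n)) (allFin n)
    ≡⟨ sum-cong-≗ (λ i → ∑ˡ-allFin (λ j → ∑ˡ (λ k → f (i , j , k)) (allFin n))) ⟩
  ∑[ i < n ] ∑[ j < n ] ∑ˡ (λ k → f (i , j , k)) (allFin n)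
    ≡⟨ sum-cong-≗ (λ i → sum-cong-≗ λ j → ∑ˡ-allFin (λ k → f (i , j , k))) ⟩
  ∑[ i < n ] ∑[ j < n ] ∑[ k < n ] f (i , j , k) ∎

-- Additivity and symmetry of `weightThrough`

module _ {m n} {H : SimpleGraph (Fin m)} {G : SimpleGraph (Fin n)} where

  open WeightedCopy
  open Subgraph

  -- Trades the `filter` for an indicator factor, so that totals over the list become sums that can
  -- be split and rearranged.
  weightThrough-∷ : ∀ (c : WeightedCopy H G) cs x y →
    weightThrough (c ∷ cs) x y ≡ ⟦ edge? (subgraph c) x y ⟧ * weight c + weightThrough cs x y
  weightThrough-∷ c cs x y with edge? (subgraph c) x y
  ... | yes _ = cong (_+ weightThrough cs x y) (sym (*-identityˡ (weight c)))
  ... | no  _ = sym (trans (cong (_+ weightThrough cs x y) (*-zeroˡ (weight c))) (+-identityˡ (weightThrough cs x y)))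

  weightThrough-++ : ∀ (cs ds : List (WeightedCopy H G)) x y →
    weightThrough (cs ++ ds) x y ≡ weightThrough cs x y + weightThrough ds x y
  weightThrough-++ []       ds x y = sym (+-identityˡ (weightThrough ds x y))
  weightThrough-++ (c ∷ cs) ds x y = begin-equality
    weightThrough (c ∷ cs ++ ds) x y
      ≡⟨ weightThrough-∷ c (cs ++ ds) x y ⟩
    p + weightThrough (cs ++ ds) x y
      ≡⟨ cong (_+_ p) (weightThrough-++ cs ds x y) ⟩
    p + (weightThrough cs x y + weightThrough ds x y)
      ≡⟨ +-assoc p (weightThrough cs x y) (weightThrough ds x y) ⟨
    p + weightThrough cs x y + weightThrough ds x y
      ≡⟨ cong (_+ weightThrough ds x y) (weightThrough-∷ c cs x y) ⟨
    weightThrough (c ∷ cs) x y + weightThrough ds x y ∎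
    where p = ⟦ edge? (subgraph c) x y ⟧ * weight c

  weightThrough-concatMap : ∀ {A : Set} (f : A → List (WeightedCopy H G)) as x y →
    weightThrough (concatMap f as) x y ≡ ∑ˡ (λ a → weightThrough (f a) x y) as
  weightThrough-concatMap f []       x y = refl
  weightThrough-concatMap f (a ∷ as) x y = trans (weightThrough-++ (f a) (concatMap f as) x y)
    (cong (_+_ (weightThrough (f a) x y)) (weightThrough-concatMap f as x y))

  weightThrough-sym : ∀ (cs : List (WeightedCopy H G)) x y → weightThrough cs x y ≡ weightThrough cs y x
  weightThrough-sym []       x y = refl
  weightThrough-sym (c ∷ cs) x y = begin-equality
    weightThrough (c ∷ cs) x y
      ≡⟨ weightThrough-∷ c cs x y ⟩
    ⟦ edge? S x y ⟧ * weight c + weightThrough cs x y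
      ≡⟨ cong₂ (λ p q → p * weight c + q) (⟦⟧-cong (edge? S x y) (edge? S y x) (edge-sym S) (edge-sym S))
           (weightThrough-sym cs x y) ⟩
    ⟦ edge? S y x ⟧ * weight c + weightThrough cs y x
      ≡⟨ weightThrough-∷ c cs y x ⟨
    weightThrough (c ∷ cs) y x ∎
    where S = subgraph c

-- Triangles of a graph as copies of K₃

module Triangles {n} (G : SimpleGraph (Fin n)) where

  open SimpleGraph G using (Adj; adj?) renaming (sym to adj-sym; irrefl to adj-irrefl)

  -- The increasing order selects one of the six orderings of each triangle, so that no copy is
  -- listed twice.
  record Triangle (i j k : Fin n) : Set where
    constructor triangle
    field
      i<j  : i Fin.< j
      j<k  : j Fin.< k
      i~j  : Adj i j
      i~k  : Adj i k
      j~k  : Adj j k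

  triangle? : (i j k : Fin n) → Dec (Triangle i j k)
  triangle? i j k = map′
    (λ ((p , q) , r , s , t) → triangle p q r s t)
    (λ (triangle p q r s t) → (p , q) , r , s , t)
    ((i Fin.<? j ×-dec j Fin.<? k) ×-dec adj? i j ×-dec adj? i k ×-dec adj? j k)

  corner : (i j k : Fin n) → Fin 3 → Fin n
  corner i j k 0F = i
  corner i j k 1F = j
  corner i j k 2F = k

  -- Describes the same set as `corners`, but with an index in `Fin 3`: the isomorphism with
  -- `complete 3` and the case analysis on edges both work on that index.
  IsCorner : (i j k x : Fin n) → Set
  IsCorner i j k x = ∃[ m ] x ≡ corner i j k m

  isCorner? : ∀ i j k x → Dec (IsCorner i j k x)
  isCorner? i j k x = Fin.any? λ m → x Fin.≟ corner i j k m

  corners : (i j k : Fin n) → Subset n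
  corners i j k = ⁅ i ⁆ ∪ (⁅ j ⁆ ∪ ⁅ k ⁆)

  ∈⇒isCorner : ∀ {i j k x} → x ∈ corners i j k → IsCorner i j k x
  ∈⇒isCorner {i} {j} {k} x∈ with x∈p∪q⁻ ⁅ i ⁆ (⁅ j ⁆ ∪ ⁅ k ⁆) x∈
  ... | inj₁ x∈i = 0F , x∈⁅y⁆⇒x≡y i x∈i
  ... | inj₂ x∈jk with x∈p∪q⁻ ⁅ j ⁆ ⁅ k ⁆ x∈jk
  ...   | inj₁ x∈j = 1F , x∈⁅y⁆⇒x≡y j x∈j
  ...   | inj₂ x∈k = 2F , x∈⁅y⁆⇒x≡y k x∈k

  corner∈ : ∀ {i j k} m → corner i j k m ∈ corners i j k
  corner∈ {i} 0F = x∈p∪q⁺ (inj₁ (x∈⁅x⁆ i))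
  corner∈ {i} {j} {k} 1F = x∈p∪q⁺ {p = ⁅ i ⁆} (inj₂ (x∈p∪q⁺ (inj₁ (x∈⁅x⁆ j))))
  corner∈ {i} {j} {k} 2F = x∈p∪q⁺ {p = ⁅ i ⁆} (inj₂ (x∈p∪q⁺ {p = ⁅ j ⁆} (inj₂ (x∈⁅x⁆ k))))

  isCorner⇒∈ : ∀ {i j k x} → IsCorner i j k x → x ∈ corners i j k
  isCorner⇒∈ (m , refl) = corner∈ m

  module _ {i j k} (t : Triangle i j k) where

    open Triangle t

    corner-adj : ∀ {l m} → l ≢ m → Adj (corner i j k l) (corner i j k m)
    corner-adj {0F} {0F} l≢m = contradiction refl l≢m
    corner-adj {0F} {1F} l≢m = i~j
    corner-adj {0F} {2F} l≢m = i~k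
    corner-adj {1F} {0F} l≢m = adj-sym i~j
    corner-adj {1F} {1F} l≢m = contradiction refl l≢m
    corner-adj {1F} {2F} l≢m = j~k
    corner-adj {2F} {0F} l≢m = adj-sym i~k
    corner-adj {2F} {1F} l≢m = adj-sym j~k
    corner-adj {2F} {2F} l≢m = contradiction refl l≢m

    corner-injective : ∀ {l m} → corner i j k l ≡ corner i j k m → l ≡ m
    corner-injective {l} {m} eq with l Fin.≟ m
    ... | yes l≡m = l≡m
    ... | no  l≢m = contradiction (subst (Adj (corner i j k l)) (sym eq) (corner-adj l≢m)) adj-irrefl

    triangleGraph : Subgraph G
    triangleGraph = record
      { vertices = corners i j k
      ; Edge     = λ x y → x ≢ y × IsCorner i j k x × IsCorner i j k y
      ; edge?    = λ x y → ¬? (x Fin.≟ y) ×-dec isCorner? i j k x ×-dec isCorner? i j k y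
      ; edge-sym = λ (x≢y , x∈ , y∈) → ≢-sym x≢y , y∈ , x∈
      ; edge⇒adj = λ { (x≢y , (l , refl) , (m , refl)) → corner-adj (x≢y ∘ cong (corner i j k)) }
      ; edge⇒∈   = λ (_ , x∈ , y∈) → isCorner⇒∈ x∈ , isCorner⇒∈ y∈
      }

    triangleGraph≅K₃ : Subgraph.toGraph triangleGraph ≅ complete 3
    triangleGraph≅K₃ = record
      { vertices↔ = mk↔ₛ′ index (λ m → corner i j k m , corner∈ m)
          (λ m → corner-injective (corner-index (corner i j k m , corner∈ m)))
          (λ v → vertex-≡ (corner-index v))
      ; adj⇔ = λ v w → mk⇔
          (λ (v≢w , _) eq → v≢w (trans (sym (corner-index v)) (trans (cong (corner i j k) eq) (corner-index w))))
          (λ l≢m → (λ eq → l≢m (corner-injective (trans (corner-index v) (trans eq (sym (corner-index w))))))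
                   , ∈⇒isCorner (proj₂ v) , ∈⇒isCorner (proj₂ w))
      }
      where
      index : ∃ (_∈ corners i j k) → Fin 3
      index (x , x∈) = proj₁ (∈⇒isCorner x∈)

      corner-index : ∀ v → corner i j k (index v) ≡ proj₁ v
      corner-index (x , x∈) = sym (proj₂ (∈⇒isCorner {i} {j} {k} x∈))

      -- Vertices of `toGraph` carry membership proofs; these are unique, so the underlying vertices
      -- decide equality.
      vertex-≡ : ∀ {v w : ∃ (_∈ corners i j k)} → proj₁ v ≡ proj₁ w → v ≡ w
      vertex-≡ {x , p} {.x , q} refl = cong (x ,_) ([]=-irrelevant p q)

    i-min : ∀ m → i Fin.≤ corner i j k m
    i-min 0F = ℕ.≤-refl
    i-min 1F = ℕ.<⇒≤ i<j
    i-min 2F = ℕ.<⇒≤ (ℕ.<-trans i<j j<k)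

    k-max : ∀ m → corner i j k m Fin.≤ k
    k-max 0F = ℕ.<⇒≤ (ℕ.<-trans i<j j<k)
    k-max 1F = ℕ.<⇒≤ j<k
    k-max 2F = ℕ.≤-refl

  -- The vertex set determines the sorted triple: `i` is its minimum, `k` its maximum and `j` the
  -- element that remains. Hence listed copies already differ in their vertex sets.
  corners-injective : ∀ {i j k i′ j′ k′} → Triangle i j k → Triangle i′ j′ k′ →
                      corners i j k ≡ corners i′ j′ k′ → (i , j , k) ≡ (i′ , j′ , k′)
  corners-injective {i} {j} {k} {i′} {j′} {k′} t t′ eq = cong₂ _,_ i≡i′ (cong₂ _,_ j≡j′ k≡k′)
    where
    to : ∀ m → IsCorner i′ j′ k′ (corner i j k m)
    to m = ∈⇒isCorner (subst (corner i j k m ∈_) eq (corner∈ m))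
    from : ∀ m → IsCorner i j k (corner i′ j′ k′ m)
    from m = ∈⇒isCorner (subst (corner i′ j′ k′ m ∈_) (sym eq) (corner∈ m))

    i≡i′ : i ≡ i′
    i≡i′ = Fin.≤-antisym
      (subst (i Fin.≤_) (sym (proj₂ (from 0F))) (i-min t (proj₁ (from 0F))))
      (subst (i′ Fin.≤_) (sym (proj₂ (to 0F))) (i-min t′ (proj₁ (to 0F))))

    k≡k′ : k ≡ k′
    k≡k′ = Fin.≤-antisym
      (subst (Fin._≤ k′) (sym (proj₂ (to 2F))) (k-max t′ (proj₁ (to 2F))))
      (subst (Fin._≤ k) (sym (proj₂ (from 2F))) (k-max t (proj₁ (from 2F))))

    j≡j′ : j ≡ j′
    j≡j′ with to 1F
    ... | 0F , j≡i′ = contradiction (trans i≡i′ (sym j≡i′)) (Fin.<⇒≢ (Triangle.i<j t))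
    ... | 1F , j≡j′ = j≡j′
    ... | 2F , j≡k′ = contradiction (trans j≡k′ (sym k≡k′)) (Fin.<⇒≢ (Triangle.j<k t))

  -- A decomposition from symmetric weights on ordered triples

  module _ (w : (x y z : Fin n) → ℚ)
           (w-pos : ∀ {x y z} → Adj x y → Adj x z → Adj y z → 0ℚ < w x y z)
           (w≡0 : ∀ x y z → ¬ (Adj x y × Adj x z × Adj y z) → w x y z ≡ 0ℚ)
           (w-swap₁₂ : ∀ x y z → w x y z ≡ w y x z)
           (w-swap₂₃ : ∀ x y z → w x y z ≡ w x z y)
           (∑w : ∀ x y → Adj x y → ∑[ z < n ] w x y z ≡ 1ℚ) where

    copy : ∀ {i j k} → Triangle i j k → WeightedCopy (complete 3) G
    copy {i} {j} {k} t = record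
      { subgraph   = triangleGraph t
      ; isCopy     = triangleGraph≅K₃ t
      ; weight     = w i j k
      ; weight-pos = w-pos i~j i~k j~k
      }
      where open Triangle t

    copiesAt : Fin n × Fin n × Fin n → List (WeightedCopy (complete 3) G)
    copiesAt (i , j , k) with triangle? i j k
    ... | yes t = copy t ∷ []
    ... | no  _ = []

    copies : List (WeightedCopy (complete 3) G)
    copies = concatMap copiesAt (triples n)

    copies-distinct : AllPairs (λ c d → ¬ (c ≈ d)) copies
    copies-distinct = AllPairs.concat⁺
      (All.map⁺ (All.universal singleton (triples n)))
      (AllPairs.map⁺ (AllPairs.map (λ {t} {t′} → separate t t′)
        (cartesianProduct⁺ (allFin⁺ n) (cartesianProduct⁺ (allFin⁺ n) (allFin⁺ n)))))
      where
      singleton : ∀ t → AllPairs (λ c d → ¬ (c ≈ d)) (copiesAt t)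
      singleton (i , j , k) with triangle? i j k
      ... | yes _ = All.[] AllPairs.∷ AllPairs.[]
      ... | no  _ = AllPairs.[]

      separate : ∀ t t′ → t ≢ t′ → All (λ c → All (λ d → ¬ (c ≈ d)) (copiesAt t′)) (copiesAt t)
      separate (i , j , k) (i′ , j′ , k′) t≢t′ with triangle? i j k | triangle? i′ j′ k′
      ... | no  _ | _      = All.[]
      ... | yes t | no  _  = All.[] All.∷ All.[]
      ... | yes t | yes t′ = ((λ (eq , _) → t≢t′ (corners-injective t t′ eq)) All.∷ All.[]) All.∷ All.[]

    sorted? : (i j k : Fin n) → Dec (i Fin.< j × j Fin.< k)
    sorted? i j k = i Fin.<? j ×-dec j Fin.<? k

    -- The weights of the listed copies, extended by 0 to all ordered triples; since `w` vanishes
    -- off triangles, cutting down to sorted triples suffices. Sums over the list thereby become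
    -- unrestricted triple sums.
    v : (i j k : Fin n) → ℚ
    v i j k = ⟦ sorted? i j k ⟧ * w i j k

    v≡0 : ∀ {i j k} → ¬ Triangle i j k → v i j k ≡ 0ℚ
    v≡0 {i} {j} {k} ¬t = vanish (sorted? i j k)
      where
      vanish : (s? : Dec (i Fin.< j × j Fin.< k)) → ⟦ s? ⟧ * w i j k ≡ 0ℚ
      vanish (no  _)           = *-zeroˡ (w i j k)
      vanish (yes (i<j , j<k)) = trans (*-identityˡ (w i j k))
        (w≡0 i j k λ (i~j , i~k , j~k) → ¬t (triangle i<j j<k i~j i~k j~k))

    module _ {x y : Fin n} (x<y : x Fin.< y) where

      δ : Fin n → Fin n → ℚ
      δ u m = ⟦ u Fin.≟ m ⟧

      -- With `x < y` and `i < j < k`, an edge can only match the corners in increasing order, which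
      -- leaves three mutually exclusive cases. As products of deltas they let the triple sum
      -- collapse.
      edge-indicator : ∀ {i j k} (t : Triangle i j k) →
        ⟦ Subgraph.edge? (triangleGraph t) x y ⟧ ≡ δ x i * δ y j + (δ x i * δ y k + δ x j * δ y k)
      edge-indicator {i} {j} {k} t = begin-equality
        ⟦ Subgraph.edge? (triangleGraph t) x y ⟧
          ≡⟨ ⟦⟧-cong (Subgraph.edge? (triangleGraph t) x y) (ij? ⊎-dec (ik? ⊎-dec jk?)) edge⇒ ⇒edge ⟩
        ⟦ ij? ⊎-dec (ik? ⊎-dec jk?) ⟧
          ≡⟨ ⟦⊎⟧ ij? (ik? ⊎-dec jk?) (λ { (refl , refl) (inj₁ (_ , j≡k)) → j≢k j≡k
                                        ; (refl , refl) (inj₂ (i≡j , _)) → i≢j i≡j }) ⟩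
        ⟦ ij? ⟧ + ⟦ ik? ⊎-dec jk? ⟧
          ≡⟨ cong (_+_ ⟦ ij? ⟧) (⟦⊎⟧ ik? jk? λ { (refl , _) (i≡j , _) → i≢j i≡j }) ⟩
        ⟦ ij? ⟧ + (⟦ ik? ⟧ + ⟦ jk? ⟧)
          ≡⟨ cong₂ _+_ (⟦×⟧ (x Fin.≟ i) (y Fin.≟ j)) (cong₂ _+_ (⟦×⟧ (x Fin.≟ i) (y Fin.≟ k)) (⟦×⟧ (x Fin.≟ j) (y Fin.≟ k))) ⟩
        δ x i * δ y j + (δ x i * δ y k + δ x j * δ y k) ∎
        where
        open Triangle t
        ij? = x Fin.≟ i ×-dec y Fin.≟ j
        ik? = x Fin.≟ i ×-dec y Fin.≟ k
        jk? = x Fin.≟ j ×-dec y Fin.≟ k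

        i≢j : i ≢ j
        i≢j = Fin.<⇒≢ i<j
        j≢k : j ≢ k
        j≢k = Fin.<⇒≢ j<k

        edge⇒ : Subgraph.Edge (triangleGraph t) x y →
                (x ≡ i × y ≡ j) ⊎ (x ≡ i × y ≡ k) ⊎ (x ≡ j × y ≡ k)
        edge⇒ (x≢y , (0F , refl) , (0F , refl)) = contradiction refl x≢y
        edge⇒ (x≢y , (0F , x≡i)  , (1F , y≡j))  = inj₁ (x≡i , y≡j)
        edge⇒ (x≢y , (0F , x≡i)  , (2F , y≡k))  = inj₂ (inj₁ (x≡i , y≡k))
        edge⇒ (x≢y , (1F , refl) , (0F , refl)) = contradiction x<y (ℕ.<-asym i<j)
        edge⇒ (x≢y , (1F , refl) , (1F , refl)) = contradiction refl x≢y
        edge⇒ (x≢y , (1F , x≡j)  , (2F , y≡k))  = inj₂ (inj₂ (x≡j , y≡k))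
        edge⇒ (x≢y , (2F , refl) , (m  , refl)) = contradiction (k-max t m) (ℕ.<⇒≱ x<y)

        ⇒edge : (x ≡ i × y ≡ j) ⊎ (x ≡ i × y ≡ k) ⊎ (x ≡ j × y ≡ k) →
                Subgraph.Edge (triangleGraph t) x y
        ⇒edge (inj₁ (x≡i , y≡j))        = Fin.<⇒≢ x<y , (0F , x≡i) , (1F , y≡j)
        ⇒edge (inj₂ (inj₁ (x≡i , y≡k))) = Fin.<⇒≢ x<y , (0F , x≡i) , (2F , y≡k)
        ⇒edge (inj₂ (inj₂ (x≡j , y≡k))) = Fin.<⇒≢ x<y , (1F , x≡j) , (2F , y≡k)

      copiesAt-weight : ∀ i j k → weightThrough (copiesAt (i , j , k)) x y ≡
        δ x i * (δ y j * v i j k) + (δ x i * (δ y k * v i j k) + δ x j * (δ y k * v i j k))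
      copiesAt-weight i j k = trans (split (triangle? i j k) refl)
        (solve 5 (λ xi yj yk xj v → (xi :* yj :+ (xi :* yk :+ xj :* yk)) :* v :=
                    xi :* (yj :* v) :+ (xi :* (yk :* v) :+ xj :* (yk :* v)))
           refl (δ x i) (δ y j) (δ y k) (δ x j) (v i j k))
        where
        D = δ x i * δ y j + (δ x i * δ y k + δ x j * δ y k)
        -- The equation is carried along so that rewriting by it unfolds `copiesAt`, which branches
        -- on `triangle? i j k`.
        split : ∀ t? → triangle? i j k ≡ t? → weightThrough (copiesAt (i , j , k)) x y ≡ D * v i j k
        split (no ¬t) eq rewrite eq = sym (trans (cong (D *_) (v≡0 ¬t)) (*-zeroʳ D))
        split (yes t) eq rewrite eq = begin-equality
          weightThrough (copy t ∷ []) x y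
            ≡⟨ weightThrough-∷ (copy t) [] x y ⟩
          ⟦ Subgraph.edge? (triangleGraph t) x y ⟧ * w i j k + 0ℚ
            ≡⟨ +-identityʳ _ ⟩
          ⟦ Subgraph.edge? (triangleGraph t) x y ⟧ * w i j k
            ≡⟨ cong₂ _*_ (edge-indicator t) (sym (trans (cong (_* w i j k) (⟦⟧-true (sorted? i j k) (i<j , j<k))) (*-identityˡ (w i j k)))) ⟩
          D * v i j k ∎
          where open Triangle t

      -- The third vertex z of a triangle through xy is its last, middle or first vertex.
      v-total : ∀ z → v x y z + (v x z y + v z x y) ≡ w x y z
      v-total z = begin-equality
        a * w x y z + (b * w x z y + c * w z x y)
          ≡⟨ cong₂ (λ p q → a * w x y z + (b * p + c * q)) (w-swap₂₃ x z y)
               (trans (w-swap₁₂ z x y) (w-swap₂₃ x z y)) ⟩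
        a * w x y z + (b * w x y z + c * w x y z)
          ≡⟨ solve 4 (λ a b c w → a :* w :+ (b :* w :+ c :* w) := (a :+ (b :+ c)) :* w) refl a b c (w x y z) ⟩
        (a + (b + c)) * w x y z
          ≡⟨ cong (_* w x y z) (sym (trans
               (⟦⊎⟧ (sorted? x y z) (sorted? x z y ⊎-dec sorted? z x y)
                 (λ { (_ , y<z) (inj₁ (_ , z<y)) → ℕ.<-asym y<z z<y
                    ; (_ , y<z) (inj₂ (z<x , _)) → ℕ.<-asym x<y (ℕ.<-trans y<z z<x) }))
               (cong (_+_ a) (⟦⊎⟧ (sorted? x z y) (sorted? z x y)
                 λ (x<z , _) (z<x , _) → ℕ.<-asym x<z z<x)))) ⟩
        ⟦ position? ⟧ * w x y z
          ≡⟨ positioned (Fin.<-cmp z x) (Fin.<-cmp z y) ⟩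
        w x y z ∎
        where
        a = ⟦ sorted? x y z ⟧
        b = ⟦ sorted? x z y ⟧
        c = ⟦ sorted? z x y ⟧
        position? = sorted? x y z ⊎-dec (sorted? x z y ⊎-dec sorted? z x y)

        holds : _ → ⟦ position? ⟧ * w x y z ≡ w x y z
        holds p = trans (cong (_* w x y z) (⟦⟧-true position? p)) (*-identityˡ (w x y z))

        -- When `z` coincides with `x` or `y` none of the three positions holds, but then `w x y z`
        -- is 0 as well.
        degenerate : w x y z ≡ 0ℚ → ⟦ position? ⟧ * w x y z ≡ w x y z
        degenerate eq = trans (cong (⟦ position? ⟧ *_) eq) (trans (*-zeroʳ ⟦ position? ⟧) (sym eq))

        positioned : Tri (z Fin.< x) (z ≡ x) (x Fin.< z) → Tri (z Fin.< y) (z ≡ y) (y Fin.< z) →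
                     ⟦ position? ⟧ * w x y z ≡ w x y z
        positioned (tri< z<x _ _)  _               = holds (inj₂ (inj₂ (z<x , x<y)))
        positioned (tri≈ _ refl _) _               = degenerate (w≡0 x y z λ (_ , x~x , _) → adj-irrefl x~x)
        positioned (tri> _ _ x<z)  (tri< z<y _ _)  = holds (inj₂ (inj₁ (x<z , z<y)))
        positioned (tri> _ _ x<z)  (tri≈ _ refl _) = degenerate (w≡0 x y z λ (_ , _ , y~y) → adj-irrefl y~y)
        positioned (tri> _ _ x<z)  (tri> _ _ y<z)  = holds (inj₁ (x<y , y<z))

      -- Each product of two deltas pins `x` and `y` to two of the three positions and leaves one
      -- free for `z`; `v-total` merges the three resulting sums.
      copies-weight : weightThrough copies x y ≡ ∑[ z < n ] w x y z
      copies-weight = begin-equality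
        weightThrough copies x y
          ≡⟨ weightThrough-concatMap copiesAt (triples n) x y ⟩
        ∑ˡ (λ t → weightThrough (copiesAt t) x y) (triples n)
          ≡⟨ ∑ˡ-triples (λ t → weightThrough (copiesAt t) x y) ⟩
        ∑³ (λ i j k → weightThrough (copiesAt (i , j , k)) x y)
          ≡⟨ ∑³-cong copiesAt-weight ⟩
        ∑³ (λ i j k → f₁ i j k + (f₂ i j k + f₃ i j k))
          ≡⟨ trans (∑³-distrib-+ f₁ _) (cong (_+_ (∑³ f₁)) (∑³-distrib-+ f₂ f₃)) ⟩
        ∑³ f₁ + (∑³ f₂ + ∑³ f₃)
          ≡⟨ cong₂ _+_ ∑f₁ (cong₂ _+_ ∑f₂ ∑f₃) ⟩
        ∑[ z < n ] v x y z + (∑[ z < n ] v x z y + ∑[ z < n ] v z x y)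
          ≡⟨ cong (_+_ (∑[ z < n ] v x y z)) (∑-distrib-+ (λ z → v x z y) (λ z → v z x y)) ⟨
        ∑[ z < n ] v x y z + ∑[ z < n ] (v x z y + v z x y)
          ≡⟨ ∑-distrib-+ (λ z → v x y z) (λ z → v x z y + v z x y) ⟨
        ∑[ z < n ] (v x y z + (v x z y + v z x y))
          ≡⟨ sum-cong-≗ v-total ⟩
        ∑[ z < n ] w x y z ∎
        where
        f₁ f₂ f₃ : Fin n → Fin n → Fin n → ℚ
        f₁ i j k = δ x i * (δ y j * v i j k)
        f₂ i j k = δ x i * (δ y k * v i j k)
        f₃ i j k = δ x j * (δ y k * v i j k)

        ∑∑∑-δ : (f : Fin n → Fin n → Fin n → ℚ) → ∑³ (λ i j k → δ x i * f i j k) ≡ ∑[ j < n ] ∑[ k < n ] f x j k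
        ∑∑∑-δ f = trans (sum-cong-≗ λ i → sum-cong-≗ λ j → sym (*-distribˡ-sum (δ x i) (f i j)))
                        (∑∑-δ x (λ i j → sum (f i j)))

        ∑f₁ : ∑³ f₁ ≡ ∑[ z < n ] v x y z
        ∑f₁ = trans (∑∑∑-δ (λ i j k → δ y j * v i j k)) (∑∑-δ y (λ j k → v x j k))
        ∑f₂ : ∑³ f₂ ≡ ∑[ z < n ] v x z y
        ∑f₂ = trans (∑∑∑-δ (λ i j k → δ y k * v i j k)) (sum-cong-≗ λ j → ∑-δ y (λ k → v x j k))
        ∑f₃ : ∑³ f₃ ≡ ∑[ z < n ] v z x y
        ∑f₃ = sum-cong-≗ λ i → trans (∑∑-δ x (λ j k → δ y k * v i j k)) (∑-δ y (λ k → v i x k))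

    decomposition : FractionalDecomposition G (complete 3)
    decomposition = record
      { copies   = copies
      ; distinct = copies-distinct
      ; covers   = covers
      }
      where
      covers : ∀ x y → Adj x y → weightThrough copies x y ≡ 1ℚ
      covers x y x~y with Fin.<-cmp x y
      ... | tri< x<y _ _  = trans (copies-weight x<y) (∑w x y x~y)
      ... | tri≈ _ refl _ = contradiction x~y adj-irrefl
      -- `copies-weight` expects the smaller endpoint first.
      ... | tri> _ _ y<x  = trans (weightThrough-sym copies x y)
                              (trans (copies-weight y<x) (∑w y x (adj-sym x~y)))

-- Graphs with minimum degree at least 19n/20

module _ {n} (G : SimpleGraph (Fin n)) {s : ℚ} (0<s : 0ℚ < s) (N≡20s : fromℕ n ≡ + 20 / 1 * s)
         (degree-bound : ∀ u → fromℕ n - s ≤ fromℕ (degree G u)) where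

  open SimpleGraph G using (Adj; adj?)
  open CliqueWeights G

  row-bound : ∀ u → N - s ≤ ∑[ v < n ] a u v
  row-bound u = ≤-trans (degree-bound u) (≤-reflexive (length-filter (adj? u) n (λ v → v)))

  N-pos : 0ℚ < N
  N-pos = subst (0ℚ <_) (sym N≡20s) (*-pos (positive⁻¹ (+ 20 / 1)) 0<s)

  E-pos : ∀ x y → 0ℚ < extensions x y
  E-pos = extensions-pos 0<s N≡20s row-bound

  w′ : (x y z : Fin n) → ℚ
  w′ = triangleWeight 0<s N≡20s row-bound

  1/N : ℚ
  1/N = reciprocal N-pos

  fractionalDecomposition : FractionalDecomposition G (complete 3)
  -- Dividing by `N` undoes the scaling: the edge totals of `w′` are `N`.
  fractionalDecomposition = Triangles.decomposition G (λ x y z → w′ x y z * 1/N)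
    (λ {x} {y} {z} x~y x~z y~z → *-pos
      (triangleWeight-pos 0<s N≡20s row-bound x y z
        (trans (clique₃ x y z) (⟦⟧-true (triple? x y z) (x~y , x~z , y~z))))
      (reciprocal-pos N-pos))
    (λ x y z ¬xyz → trans
      (cong (_* 1/N) (scaledWeight≡0 E-pos x y z (trans (clique₃ x y z) (⟦⟧-false (triple? x y z) ¬xyz))))
      (*-zeroˡ 1/N))
    (λ x y z → cong (_* 1/N) (scaledWeight-swap₁₂ E-pos x y z))
    (λ x y z → cong (_* 1/N) (scaledWeight-swap₂₃ E-pos x y z))
    ∑w
    where
    ∑w : ∀ x y → Adj x y → ∑[ z < n ] (w′ x y z * 1/N) ≡ 1ℚ
    ∑w x y x~y = begin-equality
      ∑[ z < n ] (w′ x y z * 1/N)       ≡⟨ *-distribʳ-sum 1/N (w′ x y) ⟨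
      sum (w′ x y) * 1/N                ≡⟨ cong (_* 1/N) (∑scaledWeight E-pos x y) ⟩
      clique (x ∷ y ∷ []) * N * 1/N     ≡⟨ cong (λ c → c * N * 1/N) (trans (clique₂ x y) (⟦⟧-true (adj? x y) x~y)) ⟩
      1ℚ * N * 1/N                      ≡⟨ cong (_* 1/N) (*-identityˡ N) ⟩
      N * 1/N                           ≡⟨ *-reciprocal N-pos ⟩
      1ℚ                                ∎

-- From density 27/28 to minimum degree 19n/20

fromℕ-nonNeg : ∀ n → 0ℚ ≤ fromℕ n
fromℕ-nonNeg n = nonNegative⁻¹ (fromℕ n) {{normalize-nonNeg n 1}}

fromℕ-mono-≤ : ∀ {m n} → m ℕ.≤ n → fromℕ m ≤ fromℕ n
fromℕ-mono-≤ {m} {n} m≤n = begin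
  fromℕ m                      ≡⟨ +-identityʳ (fromℕ m) ⟨
  fromℕ m + 0ℚ                 ≤⟨ +-monoʳ-≤ (fromℕ m) (fromℕ-nonNeg (n ℕ.∸ m)) ⟩
  fromℕ m + fromℕ (n ℕ.∸ m)    ≡⟨ /1-homo-+ (+ m) (+ (n ℕ.∸ m)) ⟨
  fromℕ (m ℕ.+ (n ℕ.∸ m))      ≡⟨ cong fromℕ (ℕ.m+[n∸m]≡n m≤n) ⟩
  fromℕ n                      ∎

mainTheorem2 : ∃[ v₀ ] ((v : ℕ) → v₀ ℕ.≤ v → (G : SimpleGraph (Fin v)) →
    Dense (+ 27 / 28) G → FractionalDecomposition G (complete 3))
-- Since 27/28 - 19/20 = 1/70, the inequality 19/20 N ≤ 27/28 (N - 1) amounts to N/70 ≥ 27/28, which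
-- N ≥ 70 gives with 1/28 to spare.
mainTheorem2 = 70 , λ v 70≤v G dense →
  let
    N = fromℕ v
    70≤N : + 70 / 1 ≤ N
    70≤N = fromℕ-mono-≤ 70≤v
    0<s : 0ℚ < + 1 / 20 * N
    0<s = *-pos (positive⁻¹ (+ 1 / 20)) (<-≤-trans (positive⁻¹ (+ 70 / 1)) 70≤N)
  in fractionalDecomposition G 0<s
    (solve 1 (λ N → N := con (+ 20 / 1) :* (con (+ 1 / 20) :* N)) refl N)
    λ u → begin
      N - + 1 / 20 * N
        ≡⟨ solve 1 (λ N → N :- con (+ 1 / 20) :* N :=
             con (+ 27 / 28) :* (N :- con 1ℚ) :- (con (+ 1 / 70) :* (N :- con (+ 70 / 1)) :+ con (+ 1 / 28))) refl N ⟩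
      + 27 / 28 * (N - 1ℚ) - (+ 1 / 70 * (N - + 70 / 1) + + 1 / 28)
        ≤⟨ +-monoʳ-≤ (+ 27 / 28 * (N - 1ℚ)) (neg-antimono-≤ (+-mono-≤
             (*-nonNeg (nonNegative⁻¹ (+ 1 / 70)) (p≤q⇒0≤q-p 70≤N)) (nonNegative⁻¹ (+ 1 / 28)))) ⟩
      + 27 / 28 * (N - 1ℚ) - 0ℚ
        ≡⟨ +-identityʳ (+ 27 / 28 * (N - 1ℚ)) ⟩
      + 27 / 28 * (N - 1ℚ)
        ≡⟨ cong (+ 27 / 28 *_) (/1-homo-+ (+ v) (ℤ.- 1ℤ)) ⟨
      + 27 / 28 * ((+ v ℤ.- 1ℤ) / 1)
        ≤⟨ dense u ⟩
      fromℕ (degree G u) ∎
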